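{- Let $m,n \in \mathbb{N}^*$ and $G \simeq C_m \oplus C_{mn}$. Let $S$ be a zero-sumfree sequence in $G$ with $|S| = m+mn-2$. Then: (i) if $n$ is a prime power (including $n=1$), $S$ contains at least $mn-1$ elements (counted with multiplicity) of order $mn$; (ii) if $n$ is not a prime power, $S$ contains at least $\left\lceil \frac{4}{5}mn + \frac{n-5}{5}\right\rceil$ elements (counted with multiplicity) of order $mn$.
   Context: $C_k$ denotes the cyclic group of order $k$. A sequence in a finite abelian group $G$ (written additively) is a finite list $S=(g_1,\dots,g_\ell)$ of elements of $G$ (repetitions allowed), of length $|S|=\ell$. $S$ is zero-sumfree if $\sum_{i\in I} g_i \neq 0$ for every non-empty $I \subseteq \{1,\dots,\ell\}$. (Note that $m+mn-2$ is the maximal length of a zero-sumfree sequence in $C_m\oplus C_{mn}$.) -}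

module Defs where

open import Data.Nat using (ℕ; zero; suc; _+_; _*_; _∸_; _^_; _≤_; _<_)
open import Data.Nat.DivMod using (_/_)
open import Data.Nat.Divisibility using (_∣_)
open import Data.Nat.Primality using (Prime)
open import Data.Fin using (Fin; toℕ)
open import Data.List using (List; []; map)
open import Data.Nat.ListAction using (sum)
open import Data.List.Relation.Binary.Sublist.Propositional using (_⊆_)
open import Data.Product using (_×_; Σ; ∃; proj₁; proj₂)
open import Relation.Binary.PropositionalEquality using (_≡_; _≢_)
open import Relation.Nullary using (¬_)

-- The group C_m ⊕ C_{mn}, realised concretely as Z/m × Z/mn,
-- elements represented by their canonical residues.
G : ℕ → ℕ → Set
G m n = Fin m × Fin (m * n)

Kills : (m n : ℕ) → ℕ → G m n → Set
Kills m n k g = (m ∣ k * toℕ (proj₁ g)) × ((m * n) ∣ k * toℕ (proj₂ g))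

HasOrder : (m n : ℕ) → G m n → ℕ → Set
HasOrder m n g d = (1 ≤ d) × Kills m n d g × (∀ k → 1 ≤ k → k < d → ¬ Kills m n k g)

IsZeroSum : (m n : ℕ) → List (G m n) → Set
IsZeroSum m n T = (m ∣ sum (map (λ g → toℕ (proj₁ g)) T))
                × ((m * n) ∣ sum (map (λ g → toℕ (proj₂ g)) T))

ZeroSumFree : (m n : ℕ) → List (G m n) → Set
ZeroSumFree m n S = ∀ (T : List (G m n)) → T ⊆ S → T ≢ [] → ¬ IsZeroSum m n T

-- n is a prime power p^k (k = 0 allowed, so n = 1 counts)
IsPrimePower : ℕ → Set
IsPrimePower n = Σ ℕ λ p → Σ ℕ λ k → Prime p × (n ≡ p ^ k)

ceil5 : ℕ → ℕ
ceil5 a = (a + 4) / 5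

{-# OPTIONS --safe #-}
module Submission where

open import Defs
open import Data.Nat using (ℕ; zero; suc; pred; _+_; _*_; _∸_; _^_; _≤_; _<_; z≤n; s≤s; s≤s⁻¹; NonZero; >-nonZero; >-nonZero⁻¹; nonTrivial⇒n>1)
open import Data.Nat.Properties
open import Data.Nat.Divisibility
open import Data.Nat.DivMod using (_/_; _%_; m%n<n; m≡m%n+[m/n]*n; m*[n/m]≡n; m<n*o⇒m/o<n)
open import Data.Nat.GCD using (gcd; gcd-greatest; gcd[m,n]∣m; gcd[m,n]∣n; c*gcd[m,n]≡gcd[cm,cn])
open import Data.Nat.Primality using (Prime; prime?; prime[2]; ¬prime[0]; ¬prime[1]; euclidsLemma; prime⇒nonZero; prime⇒nonTrivial; prime⇒irreducible; productOfPrimes≢0)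
open import Data.Nat.Primality.Factorisation using (PrimeFactorisation; factorise; factorisationHasAllPrimeFactors)
open import Data.Nat.ListAction using (sum; product)
open import Data.Nat.ListAction.Properties using (sum-++; sum-↭; ∈⇒∣product)
open import Data.Nat.Tactic.RingSolver using (solve-∀)
open import Data.Integer using (ℤ; +_)
import Data.Integer as ℤ
import Data.Integer.Properties as ℤ
import Data.Integer.Divisibility.Signed as ℤ
import Data.Integer.Tactic.RingSolver as ℤ-Ring
open import Data.Fin using (toℕ)
open import Data.List using (List; []; _∷_; [_]; _++_; length; map; concat; take; filter)
open import Data.List.Properties using (map-++; ++-assoc; length-++; length-take; concat-++)
open import Data.List.Membership.Propositional using (_∈_)
open import Data.List.Relation.Binary.Sublist.Propositional using (_⊆_; []; _∷_; _∷ʳ_; minimum; ⊆-refl; ⊆-trans; from∈; lookup)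
import Data.List.Relation.Binary.Sublist.Propositional.Properties as ⊆
open import Data.List.Relation.Binary.Sublist.Propositional.Properties using (length-mono-≤; take-⊆; filter-⊆)
open import Data.List.Relation.Binary.Permutation.Propositional as ↭ using (_↭_; prep; swap; ↭-refl; ↭-reflexive; ↭-sym; ↭-trans)
open import Data.List.Relation.Binary.Permutation.Propositional.Properties using (map⁺; ++⁺ˡ; ++⁺ʳ; ++-comm; shift; shifts; ↭-length; All-resp-↭)
open import Data.List.Relation.Unary.All as All using (All; []; _∷_)
open import Data.List.Relation.Unary.All.Properties as All using (¬All⇒Any¬; all-filter; take⁺)
open import Data.List.Relation.Unary.Any as Any using (Any; here; there; any?)
open import Data.Product using (_×_; _,_; Σ; ∃; ∃₂; proj₁; proj₂)
open import Data.Sum using (_⊎_; inj₁; inj₂)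
open import Data.Empty using (⊥)
open import Function using (_∘_; const; it; _$_)
open import Relation.Nullary using (¬_; Dec; yes; no; contradiction)
open import Relation.Nullary.Decidable using (¬?; _×-dec_; toWitness)
open import Relation.Unary using (Decidable)
open import Relation.Binary.PropositionalEquality using (_≡_; _≢_; _≗_; refl; sym; trans; cong; cong₂; subst; subst₂; module ≡-Reasoning)

-- Write g = (u, v). An element of order less than mn is killed by mn/q for some
-- prime q ∣ mn, so that q ∣ v, and moreover q ∣ u when q ∤ n. Elements killed by mn/q,
-- together with disjoint short blocks of the other terms whose sums are killed by mn/q,
-- form a zero-sumfree sequence in the subgroup of elements killed by mn/q, which is
-- again of rank at most two; Olson's bound D(C_m ⊕ C_mn) = m + mn − 1 there shows that
-- at most m − 1 terms have q ∣ v for a prime q ∣ n, and none has q ∣ u and q ∣ v for a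
-- prime q ∣ m with q ∤ n. Summing over the primes q ∣ n gives both bounds.
-- Olson's bound follows by the same block argument from the case C_q^r, where the
-- indicator of being zero-sum is, up to a unit modulo q, a polynomial of degree r(q − 1)
-- in the subsequence, so that its differences of higher order vanish.

private
  variable
    E : Set
    P : List E → Set
    m n k q : ℕ

-- Terms have an arbitrary type `E` and coordinates are functions on it, so that blocks of terms can
-- themselves become the terms of a new sequence.
weight : (E → ℕ) → List E → ℕ
weight w T = sum (map w T)

-- Iterated finite differences

Δ : E → (List E → ℤ) → List E → ℤ
Δ e f T = f (e ∷ T) ℤ.- f T

-- The analogue of polynomial degree: differences of order d are constant, so those of order d + 1
-- vanish.
Deg≤ : ℕ → (List E → ℤ) → Set
Deg≤ zero    f = ∀ T → f T ≡ f []
Deg≤ (suc d) f = ∀ e → Deg≤ d (Δ e f)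

Deg≤-resp-≗ : ∀ d {f g : List E → ℤ} → f ≗ g → Deg≤ d f → Deg≤ d g
Deg≤-resp-≗ zero    f≗g df T = trans (sym (f≗g T)) (trans (df T) (f≗g []))
Deg≤-resp-≗ (suc d) f≗g df e =
  Deg≤-resp-≗ d (λ T → cong₂ ℤ._-_ (f≗g (e ∷ T)) (f≗g T)) (df e)

Deg≤-+ : ∀ d {f g : List E → ℤ} → Deg≤ d f → Deg≤ d g → Deg≤ d (λ T → f T ℤ.+ g T)
Deg≤-+ zero    df dg T = cong₂ ℤ._+_ (df T) (dg T)
Deg≤-+ (suc d) {f} {g} df dg e =
  Deg≤-resp-≗ d (λ T → interchange (f (e ∷ T)) (f T) (g (e ∷ T)) (g T)) (Deg≤-+ d (df e) (dg e))
  where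
  interchange : ∀ a b c d → (a ℤ.- b) ℤ.+ (c ℤ.- d) ≡ (a ℤ.+ c) ℤ.- (b ℤ.+ d)
  interchange = ℤ-Ring.solve-∀

Deg≤-*const : ∀ d c {f : List E → ℤ} → Deg≤ d f → Deg≤ d (λ T → c ℤ.* f T)
Deg≤-*const zero    c df T = cong (c ℤ.*_) (df T)
Deg≤-*const (suc d) c {f} df e =
  Deg≤-resp-≗ d (λ T → distrib c (f (e ∷ T)) (f T)) (Deg≤-*const d c (df e))
  where
  distrib : ∀ c a b → c ℤ.* (a ℤ.- b) ≡ c ℤ.* a ℤ.- c ℤ.* b
  distrib = ℤ-Ring.solve-∀

-- Leibniz rule: with ℓ(T) = c + weight w T, the difference of ℓ f at e is (ℓ + w e) Δ e f + w e f.
-- The shift by w e is why the constant c is arbitrary.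
Deg≤-*linear : ∀ d (w : E → ℕ) c {f : List E → ℤ} → Deg≤ d f →
               Deg≤ (suc d) (λ T → + (c + weight w T) ℤ.* f T)
Deg≤-*linear zero w c {f} df e T = begin
  + (c + (w e + W)) ℤ.* f (e ∷ T) ℤ.- + (c + W) ℤ.* f T          ≡⟨ cong₂ (λ x y → + (c + (w e + W)) ℤ.* x ℤ.- + (c + W) ℤ.* y) (df (e ∷ T)) (df T) ⟩
  + (c + (w e + W)) ℤ.* f [] ℤ.- + (c + W) ℤ.* f []              ≡⟨ slope (+ c) (+ w e) (+ W) (+ 0) (f []) ⟩
  + (c + (w e + 0)) ℤ.* f [] ℤ.- + (c + 0) ℤ.* f []              ≡⟨ cong (λ x → + (c + (w e + 0)) ℤ.* x ℤ.- + (c + 0) ℤ.* f []) (df (e ∷ [])) ⟨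
  + (c + (w e + 0)) ℤ.* f (e ∷ []) ℤ.- + (c + 0) ℤ.* f []        ∎
  where
  open ≡-Reasoning
  W = weight w T
  slope : ∀ c b x y k → (c ℤ.+ (b ℤ.+ x)) ℤ.* k ℤ.- (c ℤ.+ x) ℤ.* k
                      ≡ (c ℤ.+ (b ℤ.+ y)) ℤ.* k ℤ.- (c ℤ.+ y) ℤ.* k
  slope = ℤ-Ring.solve-∀
Deg≤-*linear (suc d) w c {f} df e =
  Deg≤-resp-≗ (suc d) leibniz
    (Deg≤-+ (suc d) {λ T → + (c + w e + weight w T) ℤ.* Δ e f T} {λ T → + w e ℤ.* f T}
      (Deg≤-*linear d w (c + w e) (df e)) (Deg≤-*const (suc d) (+ w e) {f} df))
  where
  ring-leibniz : ∀ c b x a k → ((c ℤ.+ b) ℤ.+ x) ℤ.* (a ℤ.- k) ℤ.+ b ℤ.* k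
                             ≡ (c ℤ.+ (b ℤ.+ x)) ℤ.* a ℤ.- (c ℤ.+ x) ℤ.* k
  ring-leibniz = ℤ-Ring.solve-∀
  leibniz : ∀ T → + (c + w e + weight w T) ℤ.* Δ e f T ℤ.+ + w e ℤ.* f T
                ≡ + (c + (w e + weight w T)) ℤ.* f (e ∷ T) ℤ.- + (c + weight w T) ℤ.* f T
  leibniz T = ring-leibniz (+ c) (+ w e) (+ weight w T) (f (e ∷ T)) (f T)

-- Rewrite `f []` as `f (e ∷ [])` minus `Δ e f []`: the first is divisible by assumption, and
-- `Δ e f` has lower degree and inherits the divisibility on the rest of the list.
deg<length⇒∣f[] : ∀ {q : ℤ} d (f : List E → ℤ) (S : List E) → Deg≤ d f → d < length S →
                  (∀ {T} → T ⊆ S → T ≢ [] → q ℤ.∣ f T) → q ℤ.∣ f []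
deg<length⇒∣f[] {q = q} zero f (e ∷ S) df _ q∣f =
  subst (q ℤ.∣_) (df (e ∷ [])) (q∣f (refl ∷ minimum S) λ ())
deg<length⇒∣f[] {q = q} (suc d) f (e ∷ S) df (s≤s d<|S|) q∣f =
  subst (q ℤ.∣_) (cancel (f (e ∷ [])) (f []))
    (ℤ.∣m∣n⇒∣m-n (q∣f (refl ∷ minimum S) λ ())
      (deg<length⇒∣f[] d (Δ e f) S (df e) d<|S|
        λ T⊆S T≢[] → ℤ.∣m∣n⇒∣m-n (q∣f (refl ∷ T⊆S) λ ()) (q∣f (e ∷ʳ T⊆S) T≢[])))
  where
  cancel : ∀ a b → a ℤ.- (a ℤ.- b) ≡ b
  cancel = ℤ-Ring.solve-∀

-- Elementary abelian p-groups

-- For p prime, (x + 1)⋯(x + p − 1) is divisible by p exactly when x is not.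
rising : ℕ → ℕ → ℕ
rising zero    x = 1
rising (suc k) x = (suc k + x) * rising k x

∣factor⇒∣rising : ∀ {p i x} k → 1 ≤ i → i ≤ k → p ∣ i + x → p ∣ rising k x
∣factor⇒∣rising zero    1≤i i≤0 p∣ = contradiction (≤-trans 1≤i i≤0) λ ()
∣factor⇒∣rising {i = i} {x} (suc k) 1≤i i≤k p∣ with m≤n⇒m<n∨m≡n i≤k
... | inj₁ (s≤s i≤k′) = ∣n⇒∣m*n (suc k + x) (∣factor⇒∣rising k 1≤i i≤k′ p∣)
... | inj₂ refl       = ∣m⇒∣m*n (rising k x) p∣

∤⇒∣rising : ∀ {p x} .{{_ : NonZero p}} → p ∤ x → p ∣ rising (pred p) x
-- As p does not divide x, the index i = p - x % p lies between 1 and p - 1, and the factor i + x is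
-- a multiple of p.
∤⇒∣rising {p@(suc p′)} {x} p∤x = ∣factor⇒∣rising p′ (m<n⇒0<n∸m (m%n<n x p))
  (∸-monoʳ-≤ p (n≢0⇒n>0 λ r≡0 → p∤x (m%n≡0⇒n∣m x p r≡0)))
  (subst (p ∣_) (sym complement) (∣m∣n⇒∣m+n ∣-refl (n∣m*n (x / p))))
  where
  open ≡-Reasoning
  complement : (p ∸ x % p) + x ≡ p + x / p * p
  complement = begin
    (p ∸ x % p) + x                     ≡⟨ cong (_+_ (p ∸ x % p)) (m≡m%n+[m/n]*n x p) ⟩
    (p ∸ x % p) + (x % p + x / p * p)   ≡⟨ +-assoc (p ∸ x % p) (x % p) _ ⟨
    (p ∸ x % p) + x % p + x / p * p     ≡⟨ cong (_+ x / p * p) (m∸n+n≡m (<⇒≤ (m%n<n x p))) ⟩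
    p + x / p * p                       ∎

∣⇒∤rising : ∀ {p x} k → Prime p → k < p → p ∣ x → p ∤ rising k x
∣⇒∤rising zero    pr k<p p∣x p∣1 = ¬prime[1] (subst Prime (∣1⇒≡1 p∣1) pr)
∣⇒∤rising {p} {x} (suc k) pr k<p p∣x p∣r with euclidsLemma (suc k + x) (rising k x) pr p∣r
... | inj₁ p∣k+x = >⇒∤ k<p (∣m+n∣m⇒∣n (subst (p ∣_) (+-comm (suc k) x) p∣k+x) p∣x)
... | inj₂ p∣r′  = ∣⇒∤rising k pr (<-trans (n<1+n k) k<p) p∣x p∣r′

-- For p prime and k = p - 1, nonzero modulo p exactly when every weight in `ws` of T is divisible
-- by p; each weight contributes p - 1 to the degree.
detector : ℕ → List (E → ℕ) → List E → ℕ
detector k []       T = 1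
detector k (w ∷ ws) T = rising k (weight w T) * detector k ws T

Deg≤-rising : ∀ k d (w : E → ℕ) {g : List E → ℕ} → Deg≤ d (+_ ∘ g) →
              Deg≤ (k + d) (λ T → + (rising k (weight w T) * g T))
Deg≤-rising zero    d w {g} dg = Deg≤-resp-≗ d (λ T → cong +_ (sym (*-identityˡ (g T)))) dg
Deg≤-rising (suc k) d w {g} dg = Deg≤-resp-≗ (suc (k + d))
  (λ T → trans (sym (ℤ.pos-* (suc k + weight w T) _))
               (cong +_ (sym (*-assoc (suc k + weight w T) (rising k (weight w T)) (g T)))))
  (Deg≤-*linear (k + d) w (suc k) (Deg≤-rising k d w dg))

Deg≤-detector : ∀ k (ws : List (E → ℕ)) → Deg≤ (length ws * k) (+_ ∘ detector k ws)
Deg≤-detector k []       T = refl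
Deg≤-detector k (w ∷ ws) = Deg≤-rising k (length ws * k) w (Deg≤-detector k ws)

∣detector : ∀ {p k} {ws : List (E → ℕ)} {T} →
            Any (λ w → p ∣ rising k (weight w T)) ws → p ∣ detector k ws T
∣detector                      (here p∣)   = ∣m⇒∣m*n _ p∣
∣detector {k = k} {w ∷ ws} {T} (there any) = ∣n⇒∣m*n (rising k (weight w T)) (∣detector {k = k} any)

∤detector[] : ∀ {p k} → Prime p → k < p → (ws : List (E → ℕ)) → p ∤ detector k ws []
∤detector[] pr k<p [] p∣1 = ∣⇒∤rising {x = 0} 0 pr (≤-<-trans z≤n k<p) (_ ∣0) p∣1
∤detector[] {k = k} pr k<p (w ∷ ws) p∣ with euclidsLemma (rising k 0) _ pr p∣
... | inj₁ p∣r = ∣⇒∤rising k pr k<p (_ ∣0) p∣r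
... | inj₂ p∣d = ∤detector[] pr k<p ws p∣d

-- An exhaustive search, so that the argument by contradiction below still produces a subsequence.
∃⊆? : {P : List E → Set} → Decidable P → (S : List E) → Dec (∃ λ T → T ⊆ S × P T)
∃⊆? P? [] with P? []
... | yes p = yes ([] , [] , p)
... | no ¬p = no λ { (_ , [] , p) → ¬p p }
∃⊆? P? (e ∷ S) with ∃⊆? P? S | ∃⊆? (P? ∘ (e ∷_)) S
... | yes (T , T⊆S , p) | _                 = yes (T , e ∷ʳ T⊆S , p)
... | no ¬p             | yes (T , T⊆S , p) = yes (e ∷ T , refl ∷ T⊆S , p)
... | no ¬p             | no ¬p′            =
  no λ { (T , _ ∷ʳ T⊆S , p) → ¬p (T , T⊆S , p) ; (_ ∷ T , refl ∷ T⊆S , p) → ¬p′ (T , T⊆S , p) }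

≢[]? : Decidable {A = List E} (_≢ [])
≢[]? []      = no λ ≢[] → ≢[] refl
≢[]? (_ ∷ _) = yes λ ()

-- D(C_p^r) ≤ r(p − 1) + 1
elementary-davenport : ∀ {p} → Prime p → (ws : List (E → ℕ)) (S : List E) →
                       length ws * pred p < length S →
                       ∃ λ T → T ⊆ S × T ≢ [] × All (λ w → p ∣ weight w T) ws
elementary-davenport {p = p} pr ws S bound
  with ∃⊆? (λ T → ≢[]? T ×-dec All.all? (λ w → p ∣? weight w T) ws) S
... | yes found = found
... | no  none  = contradiction p∣f[] (∤detector[] pr pred<p ws)
  where
  instance
    nz : NonZero p
    nz = prime⇒nonZero pr
  pred<p : pred p < p
  pred<p = ≤-reflexive (suc-pred p)
  -- A non-empty T fails some weight, whose factor is then divisible by p; the degree being less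
  -- than the length of S, p would divide the value at `[]` as well.
  vanishes : ∀ {T} → T ⊆ S → T ≢ [] → + p ℤ.∣ + detector (pred p) ws T
  vanishes {T} T⊆S T≢[] = ℤ.∣ᵤ⇒∣ (∣detector (Any.map ∤⇒∣rising
    (¬All⇒Any¬ (λ w → p ∣? weight w T) ws λ all → none (T , T⊆S , T≢[] , all))))
  p∣f[] : p ∣ detector (pred p) ws []
  p∣f[] = ℤ.∣⇒∣ᵤ (deg<length⇒∣f[] _ _ S (Deg≤-detector (pred p) ws) bound vanishes)

-- Concatenation and permutation of sequences

weight-++ : ∀ (w : E → ℕ) S T → weight w (S ++ T) ≡ weight w S + weight w T
weight-++ w S T = trans (cong sum (map-++ w S T)) (sum-++ (map w S) (map w T))

weight-↭ : ∀ (w : E → ℕ) {S T} → S ↭ T → weight w S ≡ weight w T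
weight-↭ w S↭T = sum-↭ (map⁺ w S↭T)

weight-const1 : (T : List E) → weight (const 1) T ≡ length T
weight-const1 []      = refl
weight-const1 (_ ∷ T) = cong suc (weight-const1 T)

⊆⇒↭++ : {S T : List E} → T ⊆ S → ∃ λ R → S ↭ T ++ R
⊆⇒↭++ []                = [] , ↭-refl
⊆⇒↭++ {T = T} (e ∷ʳ T⊆S) with R , S↭ ← ⊆⇒↭++ T⊆S = e ∷ R , ↭-trans (prep e S↭) (↭-sym (shift e T R))
⊆⇒↭++ {S = e ∷ _} (refl ∷ T⊆S) with R , S↭ ← ⊆⇒↭++ T⊆S = R , prep e S↭

concat-↭ : {Bs Cs : List (List E)} → Bs ↭ Cs → concat Bs ↭ concat Cs
concat-↭ ↭.refl          = ↭-refl
concat-↭ (prep B p)      = ++⁺ˡ B (concat-↭ p)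
concat-↭ (swap B C p)    = ↭-trans (++⁺ˡ B (++⁺ˡ C (concat-↭ p))) (shifts B C)
concat-↭ (↭.trans p p′)  = ↭-trans (concat-↭ p) (concat-↭ p′)

-- Disjoint blocks

-- Keeping the complement R, up to permutation, lets further disjoint blocks be taken from it.
HasBlock : (List E → Set) → List E → Set
HasBlock P S = ∃₂ λ T R → S ↭ T ++ R × T ≢ [] × P T

HasShortBlock : ℕ → (List E → Set) → List E → Set
HasShortBlock q P = HasBlock (λ T → length T ≤ q × P T)

HasBlocks : ℕ → (List E → Set) → List E → Set
HasBlocks k P S = ∃₂ λ Bs R → S ↭ concat Bs ++ R × All (λ B → B ≢ [] × P B) Bs × length Bs ≡ k

HasBlock-⊆ : {S T : List E} → T ⊆ S → T ≢ [] → P T → HasBlock P S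
HasBlock-⊆ T⊆S T≢[] PT with R , S↭ ← ⊆⇒↭++ T⊆S = _ , R , S↭ , T≢[] , PT

HasBlocks-∷ : ∀ {S T R : List E} → S ↭ T ++ R → T ≢ [] → P T → HasBlocks k P R → HasBlocks (suc k) P S
HasBlocks-∷ {T = T} S↭ T≢[] PT (Bs , R′ , R↭ , all , len) =
  T ∷ Bs , R′ , ↭-trans S↭ (↭-trans (++⁺ˡ T R↭) (↭-reflexive (sym (++-assoc T (concat Bs) R′))))
  , (T≢[] , PT) ∷ all , cong suc len

HasBlocks-0 : {S : List E} → HasBlocks 0 P S
HasBlocks-0 {S = S} = [] , S , ↭-refl , [] , refl

-- Terms that satisfy P on their own cost one term per block; this surplus of blocks is what bounds
-- the number of such terms later.
HasBlocks-singletons : ∀ {X Y : List E} → All (P ∘ [_]) X → HasBlocks k P Y → HasBlocks (length X + k) P (X ++ Y)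
HasBlocks-singletons []       blocks = blocks
HasBlocks-singletons (p ∷ ps) blocks = HasBlocks-∷ {T = [ _ ]} ↭-refl (λ ()) p (HasBlocks-singletons ps blocks)

HasBlocks-↭ : {S S′ : List E} → S ↭ S′ → HasBlocks k P S′ → HasBlocks k P S
HasBlocks-↭ S↭S′ (Bs , R , S′↭ , rest) = Bs , R , ↭-trans S↭S′ S′↭ , rest

-- Short blocks are split off as long as possible; the last block may be long.
greedy-blocks : ∀ q c →
                (∀ S → q + c ≤ length S → HasBlock P S) →
                (∀ S → q + (q + c) ≤ length S → HasShortBlock {E} q P S) →
                ∀ k S → k * q + c ≤ length S → HasBlocks k P S
greedy-blocks q c block short zero    S _ = HasBlocks-0
greedy-blocks q c block short (suc zero) S bound
  with T , R , S↭ , T≢[] , PT ← block S (subst (λ x → x + c ≤ length S) (*-identityˡ q) bound)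
  = HasBlocks-∷ S↭ T≢[] PT HasBlocks-0
greedy-blocks q c block short (suc (suc k)) S bound =
  let T , R , S↭ , T≢[] , |T|≤q , PT = short S
        (≤-trans (m≤m+n _ (k * q)) (≤-trans (≤-reflexive (reorder q (k * q) c)) bound))
  in HasBlocks-∷ S↭ T≢[] PT (greedy-blocks q c block short (suc k) R
      (+-cancelˡ-≤ q _ _ (≤-trans (≤-reflexive (sym (+-assoc q (q + k * q) c)))
        (≤-trans bound (≤-trans (≤-reflexive (trans (↭-length S↭) (length-++ T))) (+-monoˡ-≤ (length R) |T|≤q))))))
  where
  reorder : ∀ q x c → q + (q + c) + x ≡ q + (q + x) + c
  reorder = solve-∀

-- Olson's bound for groups of rank at most two

ZeroSum : ℕ → ℕ → (E → ℕ) → (E → ℕ) → List E → Set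
ZeroSum m k u v T = m ∣ weight u T × k ∣ weight v T

-- D(C_m ⊕ C_k) ≤ m + k − 1
Davenport : ℕ → ℕ → Set₁
Davenport m k = ∀ {E : Set} (u v : E → ℕ) S → m + k ≤ suc (length S) → HasBlock (ZeroSum m k u v) S

-- The blocks are treated as the elements of a new sequence in aC ⊕ bC.
regroup : ∀ {a b} .{{_ : NonZero a}} .{{_ : NonZero b}} → Davenport m k → (u v : E → ℕ) →
          ∀ {S} K → m + k ≤ suc K → HasBlocks K (ZeroSum a b u v) S → HasBlock (ZeroSum (a * m) (b * k) u v) S
regroup {a = a} {b} dav u v {S} K m+k≤ (Bs , R , S↭ , all , refl)
  -- The block sums are multiples of a and b; their quotients are the coordinates of a sequence in
  -- C_m ⊕ C_k.
  with dav (λ B → weight u B / a) (λ B → weight v B / b) Bs m+k≤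
... | T , R′ , Bs↭ , T≢[] , m∣ , k∣ =
  concat T , concat R′ ++ R , S↭′ , concat≢[] T≢[] (All.map proj₁ allT)
  , subst (_ ∣_) (sym (weight-concat u (All.map (proj₁ ∘ proj₂) allT))) (*-monoʳ-∣ a m∣)
  , subst (_ ∣_) (sym (weight-concat v (All.map (proj₂ ∘ proj₂) allT))) (*-monoʳ-∣ b k∣)
  where
  allT = All.++⁻ˡ T (All-resp-↭ Bs↭ all)
  S↭′ : S ↭ concat T ++ (concat R′ ++ R)
  S↭′ = ↭-trans S↭ (↭-trans (++⁺ʳ R (concat-↭ Bs↭)) (↭-reflexive
    (trans (cong (_++ R) (sym (concat-++ T R′))) (++-assoc (concat T) (concat R′) R))))
  concat≢[] : ∀ {Bs : List (List _)} → Bs ≢ [] → All (_≢ []) Bs → concat Bs ≢ []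
  concat≢[] {[]}           Bs≢[] _           = λ _ → Bs≢[] refl
  concat≢[] {[] ∷ _}       _     (B≢[] ∷ _)  = λ _ → B≢[] refl
  concat≢[] {(_ ∷ _) ∷ _}  _     _           = λ ()
  weight-concat : ∀ {a} .{{_ : NonZero a}} w {Bs} → All (λ B → a ∣ weight w B) Bs →
                  weight w (concat Bs) ≡ a * weight (λ B → weight w B / a) Bs
  weight-concat {a} w []                    = sym (*-zeroʳ a)
  weight-concat {a} w {B ∷ Bs} (a∣B ∷ a∣Bs) = begin
    weight w (B ++ concat Bs)                                     ≡⟨ weight-++ w B (concat Bs) ⟩
    weight w B + weight w (concat Bs)                             ≡⟨ cong₂ _+_ (sym (m*[n/m]≡n a∣B)) (weight-concat w a∣Bs) ⟩
    a * (weight w B / a) + a * weight (λ B → weight w B / a) Bs   ≡⟨ *-distribˡ-+ a _ _ ⟨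
    a * (weight w B / a + weight (λ B → weight w B / a) Bs)       ∎
    where open ≡-Reasoning

-- Only the first q terms are searched, which bounds the length of the block. The modulus 1 leaves u
-- unconstrained.
C_p-short-block : Prime q → (u v : E → ℕ) (S : List E) → q ≤ length S → HasShortBlock q (ZeroSum 1 q u v) S
C_p-short-block {zero}       pr = contradiction pr ¬prime[0]
C_p-short-block {q@(suc q′)} pr u v S q≤ =
  let T , T⊆ , T≢[] , q∣ = elementary-davenport pr (v ∷ []) (take q S)
        (subst₂ _<_ (sym (*-identityˡ q′)) (sym |take|) (n<1+n q′))
  in HasBlock-⊆ (⊆-trans T⊆ (take-⊆ q S)) T≢[]
       (subst (length T ≤_) |take| (length-mono-≤ T⊆) , 1∣ _ , All.head q∣)
  where
  |take| : length (take q S) ≡ q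
  |take| = trans (length-take q S) (m≤n⇒m⊓n≡m q≤)

C_p²-block : Prime q → (u v : E → ℕ) (S : List E) → q + pred q ≤ length S → HasBlock (ZeroSum q q u v) S
C_p²-block {zero}       pr = contradiction pr ¬prime[0]
C_p²-block {q@(suc q′)} pr u v S bound
  with T , T⊆ , T≢[] , q∣u ∷ q∣v ∷ [] ← elementary-davenport pr (u ∷ v ∷ []) S
         (subst (λ x → suc x ≤ length S) (cong (_+_ q′) (sym (+-identityʳ q′))) bound)
  = HasBlock-⊆ T⊆ T≢[] (q∣u , q∣v)

-- The complement V of U in T is zero-sum too, and as the two have 2q terms together, one has at
-- most q.
halve : ∀ (u v : E → ℕ) {T} → ZeroSum q q u v T → length T ≡ q + q →
        (∃₂ λ U V → T ↭ U ++ V × U ≢ [] × V ≢ [] × ZeroSum q q u v U) → HasShortBlock q (ZeroSum q q u v) T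
halve {q = q} u v {T} (q∣uT , q∣vT) |T| (U , V , T↭ , U≢[] , V≢[] , q∣uU , q∣vU) with ≤-total (length U) q
... | inj₁ |U|≤q = U , V , T↭ , U≢[] , |U|≤q , q∣uU , q∣vU
... | inj₂ q≤|U| = V , U , ↭-trans T↭ (++-comm U V) , V≢[]
  , +-cancelˡ-≤ q _ _ (≤-trans (+-monoˡ-≤ (length V) q≤|U|)
      (≤-reflexive (trans (sym (trans (↭-length T↭) (length-++ U))) |T|)))
  , rest u q∣uT q∣uU , rest v q∣vT q∣vU
  where
  rest : ∀ w → q ∣ weight w T → q ∣ weight w U → q ∣ weight w V
  rest w q∣T = ∣m+n∣m⇒∣n (subst (q ∣_) (trans (weight-↭ w T↭) (weight-++ w U V)) q∣T)

-- The constant weight 1 forces a zero-sum subsequence of at most 3q − 1 terms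
-- to have length q or 2q; in the latter case it splits into two, one of them short.
C_p²-short-block : Prime q → (u v : E → ℕ) (S : List E) → q + (q + pred q) ≤ length S →
                   HasShortBlock q (ZeroSum q q u v) S
C_p²-short-block {zero}       pr = contradiction pr ¬prime[0]
C_p²-short-block {q@(suc q′)} {E} pr u v S bound =
  -- Three weights require more than 3(q - 1) terms; taking just 3q - 1 of them excludes every
  -- multiple of q beyond 2q as a length.
  let T , T⊆ , T≢[] , q∣ = elementary-davenport pr (u ∷ v ∷ const 1 ∷ []) (take (q + (q + q′)) S)
        (subst (3 * q′ <_) (sym |take|) (≤-trans (m≤m+n (suc (3 * q′)) 1) (≤-reflexive (arith q′))))
  in conclude T⊆ T≢[] (All.head q∣ , All.head (All.tail q∣))
       (subst (q ∣_) (weight-const1 T) (All.head (All.tail (All.tail q∣))))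
  where
  arith : ∀ x → suc (3 * x) + 1 ≡ suc x + (suc x + x)
  arith = solve-∀
  |take| : length (take (q + (q + q′)) S) ≡ q + (q + q′)
  |take| = trans (length-take _ S) (m≤n⇒m⊓n≡m bound)
  within-S : ∀ {T} → T ⊆ take (q + (q + q′)) S → HasShortBlock q (ZeroSum q q u v) T → HasShortBlock q (ZeroSum q q u v) S
  within-S T⊆ (U , V , T↭ , rest) with R , S↭ ← ⊆⇒↭++ (⊆-trans T⊆ (take-⊆ _ S)) =
    U , V ++ R , ↭-trans S↭ (↭-trans (++⁺ʳ R T↭) (↭-reflexive (++-assoc U V R))) , rest
  conclude : ∀ {T} → T ⊆ take (q + (q + q′)) S → T ≢ [] → ZeroSum q q u v T → q ∣ length T →
             HasShortBlock q (ZeroSum q q u v) S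
  conclude {[]}    T⊆ T≢[] _ _ = contradiction refl T≢[]
  conclude {t ∷ T} T⊆ T≢[] zs (divides 1 |T|) =
    HasBlock-⊆ (⊆-trans T⊆ (take-⊆ _ S)) T≢[] (≤-reflexive (trans |T| (*-identityˡ q)) , zs)
  conclude {t ∷ T} T⊆ T≢[] zs (divides 2 |T|) =
    -- Setting t aside leaves 2q - 1 terms, enough for a block U; t joins the complement, which is
    -- thereby non-empty.
    let U , V , T↭ , U≢[] , zsU = C_p²-block pr u v T (≤-reflexive (suc-injective (sym (trans |T| (arith₂ q′)))))
    in within-S T⊆ (halve u v zs (trans |T| (cong (_+_ q) (+-identityʳ q)))
        (U , t ∷ V , ↭-trans (prep t T↭) (↭-sym (shift t U V)) , U≢[] , (λ ()) , zsU))
    where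
    arith₂ : ∀ x → 2 * suc x ≡ suc (suc x + x)
    arith₂ = solve-∀
  conclude {t ∷ T} T⊆ T≢[] zs (divides (suc (suc (suc j))) |T|) =
    contradiction (subst (length (t ∷ T) ≤_) |take| (length-mono-≤ T⊆))
      (<⇒≱ (subst (q + (q + q′) <_) (sym |T|) (+-monoʳ-< q (+-monoʳ-< q (m≤m+n q (j * q))))))

C_p-blocks : Prime q → (u v : E → ℕ) → ∀ k S → k * q ≤ length S → HasBlocks k (ZeroSum 1 q u v) S
C_p-blocks {q = q} pr u v k S bound = greedy-blocks q 0
  (λ S bound → let T , R , S↭ , T≢[] , _ , zs = C_p-short-block pr u v S (≤-trans (m≤m+n q 0) bound)
               in T , R , S↭ , T≢[] , zs)
  (λ S bound → C_p-short-block pr u v S (≤-trans (m≤m+n q (q + 0)) bound))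
  k S (subst (_≤ length S) (sym (+-identityʳ (k * q))) bound)

C_p²-blocks : Prime q → (u v : E → ℕ) → ∀ k S → k * q + pred q ≤ length S → HasBlocks k (ZeroSum q q u v) S
C_p²-blocks {q = q} pr u v = greedy-blocks q (pred q) (C_p²-block pr u v) (C_p²-short-block pr u v)

-- With M = `product qs`, qM terms contain M disjoint blocks with sum divisible by q, and M terms
-- suffice in C_M.
davenport-cyclic : ∀ {qs} → All Prime qs → Davenport 1 (product qs)
davenport-cyclic []                      u v []      (s≤s ())
davenport-cyclic []                      u v (e ∷ S) _        = [ e ] , S , ↭-refl , (λ ()) , 1∣ _ , 1∣ _
davenport-cyclic {q ∷ qs} (pr ∷ prs)     u v S       (s≤s bound) =
  regroup {{_}} {{prime⇒nonZero pr}} (davenport-cyclic prs) u v (product qs) ≤-refl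
    (C_p-blocks pr u v (product qs) S (subst (_≤ length S) (*-comm q (product qs)) bound))

-- Induction on the primes of m, down to the cyclic group C_n. For m = qM, the (M + Mn - 1) q + (q -
-- 1) terms required for M + Mn - 1 blocks in C_q ⊕ C_q number exactly qM + qMn - 1.
davenport-primes : ∀ n .{{_ : NonZero n}} {qs} → All Prime qs → Davenport (product qs) (product qs * n)
davenport-primes n [] u v S bound = subst (λ k → Davenport 1 k) (sym (trans (*-identityˡ n) (PrimeFactorisation.isFactorisation (factorise n))))
  (davenport-cyclic (PrimeFactorisation.factorsPrime (factorise n))) u v S bound
davenport-primes n {q ∷ qs} (pr ∷ prs) u v S bound =
  subst (λ k → HasBlock (ZeroSum (q * M) k u v) S) (sym (*-assoc q M n))
    (regroup {{prime⇒nonZero pr}} {{prime⇒nonZero pr}} (davenport-primes n prs) u v K (≤-reflexive (sym suc-K))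
      (C_p²-blocks pr u v K S (s≤s⁻¹ (≤-trans (≤-reflexive arith) bound))))
  where
  M = product qs
  instance
    M≢0 : NonZero M
    M≢0 = productOfPrimes≢0 prs
    q≢0 : NonZero q
    q≢0 = prime⇒nonZero pr
  K = pred (M + M * n)
  suc-K : suc K ≡ M + M * n
  suc-K = suc-pred (M + M * n) {{>-nonZero (≤-trans (>-nonZero⁻¹ M) (m≤m+n M (M * n)))}}
  arith : suc (K * q + pred q) ≡ q * M + q * M * n
  arith = begin
    suc (K * q + pred q)    ≡⟨ +-suc (K * q) (pred q) ⟨
    K * q + suc (pred q)    ≡⟨ cong (_+_ (K * q)) (suc-pred q) ⟩
    K * q + q               ≡⟨ +-comm (K * q) q ⟩
    suc K * q               ≡⟨ cong (_* q) suc-K ⟩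
    (M + M * n) * q         ≡⟨ expand M n q ⟩
    q * M + q * M * n       ∎
    where
    open ≡-Reasoning
    expand : ∀ M n q → (M + M * n) * q ≡ q * M + q * M * n
    expand = solve-∀

olson : ∀ m n .{{_ : NonZero m}} .{{_ : NonZero n}} → Davenport m (m * n)
olson m n = subst (λ m → Davenport m (m * n)) (sym (PrimeFactorisation.isFactorisation (factorise m)))
  (davenport-primes n (PrimeFactorisation.factorsPrime (factorise m)))

-- Elements of small order in a long zero-sumfree sequence

-- Otherwise m of these terms are one-term blocks, and the others yield mn′ - 1 blocks of sum
-- divisible by q. Olson's bound in C_m ⊕ C_mn′ then makes a union of blocks zero-sum.
few-multiples : ∀ m n′ {q} .{{_ : NonZero m}} .{{_ : NonZero n′}} → Prime q → (u v : E → ℕ) (S : List E) →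
                m + m * (q * n′) ≤ 2 + length S → ¬ HasBlock (ZeroSum m (m * (q * n′)) u v) S →
                length (filter (λ e → q ∣? v e) S) < m
few-multiples m n′ {q} pr u v S long free = ≰⇒> impossible
  where
  F = filter (λ e → q ∣? v e) S
  instance
    q≢0 : NonZero q
    q≢0 = prime⇒nonZero pr
    mn′≢0 : NonZero (m * n′)
    mn′≢0 = m*n≢0 m n′
  K = pred (m * n′)
  reassoc : ∀ q m n → q * (m * n) ≡ m * (q * n)
  reassoc = solve-∀
  impossible : m ≤ length F → ⊥
  impossible m≤|F| = free (subst₂ (λ a b → HasBlock (ZeroSum a b u v) S) (*-identityˡ m) (reassoc q m n′)
    (regroup (olson m n′) u v (m + K) m+mn′≤ (HasBlocks-↭ S↭ blocks)))
    where
    X = take m F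
    |X| : length X ≡ m
    |X| = trans (length-take m F) (m≤n⇒m⊓n≡m m≤|F|)
    Y = proj₁ (⊆⇒↭++ (⊆-trans (take-⊆ m F) (filter-⊆ (λ e → q ∣? v e) S)))
    S↭ : S ↭ X ++ Y
    S↭ = proj₂ (⊆⇒↭++ (⊆-trans (take-⊆ m F) (filter-⊆ (λ e → q ∣? v e) S)))
    |S| : length S ≡ m + length Y
    |S| = trans (↭-length S↭) (trans (length-++ X) (cong (_+ length Y) |X|))
    m+mn′≤ : m + m * n′ ≤ suc (m + K)
    m+mn′≤ = ≤-reflexive (trans (cong (_+_ m) (sym (suc-pred (m * n′)))) (+-suc m K))
    -- At least mqn′ - 2 terms remain and Kq = mqn′ - q are needed, so q ≥ 2 is enough.
    Kq≤ : K * q ≤ length Y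
    Kq≤ = +-cancelˡ-≤ q _ _ $ begin
      suc K * q               ≡⟨ cong (_* q) (suc-pred (m * n′)) ⟩
      m * n′ * q              ≡⟨ trans (*-comm (m * n′) q) (reassoc q m n′) ⟩
      m * (q * n′)            ≤⟨ +-cancelˡ-≤ m _ _ (≤-trans long (≤-reflexive (trans (cong (_+_ 2) |S|) (swap-sum m (length Y))))) ⟩
      2 + length Y            ≤⟨ +-monoˡ-≤ (length Y) (nonTrivial⇒n>1 q {{prime⇒nonTrivial pr}}) ⟩
      q + length Y            ∎
      where
      open ≤-Reasoning
      swap-sum : ∀ m y → 2 + (m + y) ≡ m + (2 + y)
      swap-sum = solve-∀
    blocks : HasBlocks (m + K) (ZeroSum 1 q u v) (X ++ Y)
    blocks = subst (λ k → HasBlocks (k + K) (ZeroSum 1 q u v) (X ++ Y)) |X|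
      (HasBlocks-singletons
        (take⁺ m (All.map (λ {e} q∣ → 1∣ _ , subst (q ∣_) (sym (+-identityʳ (v e))) q∣) (all-filter (λ e → q ∣? v e) S)))
        (C_p-blocks pr u v K Y Kq≤))

-- The term e would be a one-term block in C_q ⊕ C_q; with m′ + m′n - 2 blocks from the other terms
-- it reaches Olson's bound in C_m′ ⊕ C_m′n.
no-common-multiple : ∀ m′ n {q} .{{_ : NonZero m′}} .{{_ : NonZero n}} → Prime q → (u v : E → ℕ) (S : List E) →
                     q * m′ + q * m′ * n ≤ 2 + length S → ¬ HasBlock (ZeroSum (q * m′) (q * m′ * n) u v) S →
                     ∀ {e} → e ∈ S → ¬ (q ∣ u e × q ∣ v e)
no-common-multiple m′ n {q} pr u v S long free {e} e∈S (q∣u , q∣v) = free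
  (subst (λ b → HasBlock (ZeroSum (q * m′) b u v) S) (sym (*-assoc q m′ n))
    (regroup (olson m′ n) u v (suc K) (≤-reflexive (sym suc-suc-K)) (HasBlocks-↭ S↭ blocks)))
  where
  instance
    q≢0 : NonZero q
    q≢0 = prime⇒nonZero pr
    m′n≢0 : NonZero (m′ * n)
    m′n≢0 = m*n≢0 m′ n
  -- The subtraction is not truncated, since m′ and m′n are positive.
  K = (m′ + m′ * n) ∸ 2
  suc-suc-K : 2 + K ≡ m′ + m′ * n
  suc-suc-K = m+[n∸m]≡n (+-mono-≤ (>-nonZero⁻¹ m′) (>-nonZero⁻¹ (m′ * n)))
  Y = proj₁ (⊆⇒↭++ (from∈ e∈S))
  S↭ : S ↭ e ∷ Y
  S↭ = proj₂ (⊆⇒↭++ (from∈ e∈S))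
  bound : K * q + pred q ≤ length Y
  bound = +-cancelˡ-≤ 3 _ _ $ begin
    3 + (K * q + pred q)          ≡⟨ cong (_+_ 2) (sym (+-suc (K * q) (pred q))) ⟩
    2 + (K * q + suc (pred q))    ≡⟨ cong (λ x → 2 + (K * q + x)) (suc-pred q) ⟩
    2 + (K * q + q)               ≤⟨ +-monoˡ-≤ (K * q + q) (nonTrivial⇒n>1 q {{prime⇒nonTrivial pr}}) ⟩
    q + (K * q + q)               ≡⟨ cong (_+_ q) (+-comm (K * q) q) ⟩
    (2 + K) * q                   ≡⟨ cong (_* q) suc-suc-K ⟩
    (m′ + m′ * n) * q             ≡⟨ expand m′ n q ⟩
    q * m′ + q * m′ * n           ≤⟨ long ⟩
    2 + length S                  ≡⟨ cong (_+_ 2) (↭-length S↭) ⟩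
    3 + length Y                  ∎
    where
    open ≤-Reasoning
    expand : ∀ M n q → (M + M * n) * q ≡ q * M + q * M * n
    expand = solve-∀
  blocks : HasBlocks (suc K) (ZeroSum q q u v) (e ∷ Y)
  blocks = HasBlocks-singletons {X = [ e ]}
    ((subst (q ∣_) (sym (+-identityʳ (u e))) q∣u , subst (q ∣_) (sym (+-identityʳ (v e))) q∣v) ∷ [])
    (C_p²-blocks pr u v K Y bound)

-- Counting terms by filters

length-filter-∪ : {P Q R : E → Set} (P? : Decidable P) (Q? : Decidable Q) (R? : Decidable R) →
                  (∀ {e} → P e → Q e ⊎ R e) → ∀ S →
                  length (filter P? S) ≤ length (filter Q? S) + length (filter R? S)
length-filter-∪ P? Q? R? P⇒Q∪R [] = z≤n
length-filter-∪ P? Q? R? P⇒Q∪R (e ∷ S) with ih ← length-filter-∪ P? Q? R? P⇒Q∪R S | P? e | Q? e | R? e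
... | no _  | no _  | no _  = ih
... | no _  | no _  | yes _ = ≤-trans ih (+-monoʳ-≤ _ (n≤1+n _))
... | no _  | yes _ | no _  = m≤n⇒m≤1+n ih
... | no _  | yes _ | yes _ = m≤n⇒m≤1+n (≤-trans ih (+-monoʳ-≤ _ (n≤1+n _)))
... | yes _ | yes _ | no _  = s≤s ih
... | yes _ | yes _ | yes _ = s≤s (≤-trans ih (+-monoʳ-≤ _ (n≤1+n _)))
... | yes _ | no _  | yes _ = ≤-trans (s≤s ih) (≤-reflexive (sym (+-suc _ _)))
... | yes p | no ¬q | no ¬r with P⇒Q∪R p
...   | inj₁ q = contradiction q ¬q
...   | inj₂ r = contradiction r ¬r

length-filter-any : ∀ (v : E → ℕ) qs b S → All (λ q → length (filter (λ e → q ∣? v e) S) ≤ b) qs →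
                    length (filter (λ e → any? (_∣? v e) qs) S) ≤ length qs * b
length-filter-any v [] b S [] = ≤-reflexive (cong length (filter-none S))
  where
  filter-none : ∀ S → filter (λ e → any? (_∣? v e) []) S ≡ []
  filter-none []      = refl
  filter-none (_ ∷ S) = filter-none S
length-filter-any v (q ∷ qs) b S (≤b ∷ ≤bs) = ≤-trans
  (length-filter-∪ (λ e → any? (_∣? v e) (q ∷ qs)) (λ e → q ∣? v e) (λ e → any? (_∣? v e) qs)
    (λ { (here p) → inj₁ p ; (there p) → inj₂ p }) S)
  (+-mono-≤ ≤b (length-filter-any v qs b S ≤bs))

length-filter-∁ : {P : E → Set} (P? : Decidable P) → ∀ S →
                  length S ≡ length (filter (¬? ∘ P?) S) + length (filter P? S)
length-filter-∁ P? [] = refl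
length-filter-∁ P? (e ∷ S) with P? e
... | yes _ = trans (cong suc (length-filter-∁ P? S)) (sym (+-suc _ _))
... | no  _ = cong suc (length-filter-∁ P? S)

-- Blocks are known up to permutation, whereas `ZeroSumFree` speaks of sublists in the given order;
-- this passes from the former to the latter.
⊆-resp-↭ : ∀ {S S′ T : List E} → T ⊆ S′ → S′ ↭ S → ∃ λ T′ → T′ ⊆ S × T′ ↭ T
⊆-resp-↭ τ ↭.refl = _ , τ , ↭-refl
⊆-resp-↭ (x ∷ʳ τ) (prep x p) = let T′ , τ′ , p′ = ⊆-resp-↭ τ p in T′ , x ∷ʳ τ′ , p′
⊆-resp-↭ (refl ∷ τ) (prep x p) = let T′ , τ′ , p′ = ⊆-resp-↭ τ p in x ∷ T′ , refl ∷ τ′ , prep x p′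
⊆-resp-↭ (x ∷ʳ (y ∷ʳ τ)) (swap x y p) = let T′ , τ′ , p′ = ⊆-resp-↭ τ p in T′ , y ∷ʳ (x ∷ʳ τ′) , p′
⊆-resp-↭ (x ∷ʳ (refl ∷ τ)) (swap x y p) = let T′ , τ′ , p′ = ⊆-resp-↭ τ p in y ∷ T′ , refl ∷ (x ∷ʳ τ′) , prep y p′
⊆-resp-↭ (refl ∷ (y ∷ʳ τ)) (swap x y p) = let T′ , τ′ , p′ = ⊆-resp-↭ τ p in x ∷ T′ , y ∷ʳ (refl ∷ τ′) , prep x p′
⊆-resp-↭ (refl ∷ (refl ∷ τ)) (swap x y p) = let T′ , τ′ , p′ = ⊆-resp-↭ τ p in y ∷ x ∷ T′ , refl ∷ (refl ∷ τ′) , swap y x p′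
⊆-resp-↭ τ (↭.trans p q) =
  let T′ , τ′ , p′ = ⊆-resp-↭ τ p
      T″ , τ″ , p″ = ⊆-resp-↭ τ′ q
  in T″ , τ″ , ↭-trans p″ p′

-- Elements of order mn

prime-divisor : ∀ c .{{_ : NonZero c}} → c ≢ 1 → ∃ λ q → Prime q × q ∣ c
prime-divisor c c≢1 with factorise c
... | record { factors = [] ; isFactorisation = c≡1 } = contradiction c≡1 c≢1
... | record { factors = q ∷ qs ; isFactorisation = c≡ ; factorsPrime = pr ∷ _ } =
  q , pr , subst (q ∣_) (sym c≡) (m∣m*n (product qs))

∣*-gcd : ∀ {a} k l x → a ∣ k * x → a ∣ l * x → a ∣ gcd k l * x
∣*-gcd {a} k l x a∣kx a∣lx = subst (a ∣_) (trans (sym (c*gcd[m,n]≡gcd[cm,cn] x k l)) (*-comm x _))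
  (gcd-greatest (subst (a ∣_) (*-comm k x) a∣kx) (subst (a ∣_) (*-comm l x) a∣lx))

-- If k < mn kills g, so does d = gcd(k, mn) < mn. A prime p dividing mn/d satisfies p ∣ v and p ∣
-- un, which contradicts the first hypothesis if p ∣ n and the second if p ∣ m and p ∣ u.
hasOrder-mn : ∀ m n .{{_ : NonZero m}} .{{_ : NonZero n}} (g : G m n) →
              (∀ {q} → Prime q → q ∣ n → q ∤ toℕ (proj₂ g)) →
              (∀ {q} → Prime q → q ∣ m → ¬ (q ∣ toℕ (proj₁ g) × q ∣ toℕ (proj₂ g))) →
              HasOrder m n g (m * n)
hasOrder-mn m n g q∤v ¬q∣uv = >-nonZero⁻¹ (m * n) {{mn≢0}} , kills-mn , minimal
  where
  u = toℕ (proj₁ g)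
  v = toℕ (proj₂ g)
  mn≢0 = m*n≢0 m n
  kills-mn : Kills m n (m * n) g
  kills-mn = ∣m⇒∣m*n u (m∣m*n n) , m∣m*n v
  minimal : ∀ k → 1 ≤ k → k < m * n → ¬ Kills m n k g
  minimal k 1≤k k<mn (m∣ku , mn∣kv) = impossible
    where
    d = gcd k (m * n)
    d∣mn = gcd[m,n]∣n k (m * n)
    c = quotient d∣mn
    mn≡cd : m * n ≡ c * d
    mn≡cd = m∣n⇒n≡quotient*m d∣mn
    instance
      c≢0 : NonZero c
      c≢0 = m*n≢0⇒m≢0 c {{subst NonZero mn≡cd mn≢0}}
      d≢0 : NonZero d
      d≢0 = m*n≢0⇒n≢0 c {{subst NonZero mn≡cd mn≢0}}
    c≢1 : c ≢ 1
    c≢1 c≡1 = <-irrefl (trans (sym (+-identityʳ d)) (sym (trans mn≡cd (cong (_* d) c≡1))))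
      (≤-<-trans (∣⇒≤ {{>-nonZero 1≤k}} (gcd[m,n]∣m k (m * n))) k<mn)
    p = proj₁ (prime-divisor c c≢1)
    pr = proj₁ (proj₂ (prime-divisor c c≢1))
    p∣c : p ∣ c
    p∣c = proj₂ (proj₂ (prime-divisor c c≢1))
    pd∣mn : p * d ∣ m * n
    pd∣mn = subst (p * d ∣_) (sym mn≡cd) (*-monoˡ-∣ d p∣c)
    p∣mn : p ∣ m * n
    p∣mn = ∣-trans (m∣m*n d) pd∣mn
    cancel-d : ∀ x → p * d ∣ d * x → p ∣ x
    cancel-d x pd∣dx = *-cancelˡ-∣ d (subst (_∣ d * x) (*-comm p d) pd∣dx)
    p∣v : p ∣ v
    p∣v = cancel-d v (∣-trans pd∣mn (∣*-gcd k (m * n) v mn∣kv (proj₂ kills-mn)))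
    m∣du : m ∣ d * u
    m∣du = ∣*-gcd k (m * n) u m∣ku (proj₁ kills-mn)
    -- Multiplying m ∣ du by n gives mn ∣ d(un), and pd divides mn.
    p∣un : p ∣ u * n
    p∣un = cancel-d (u * n) (∣-trans pd∣mn (subst (m * n ∣_) (*-assoc d u n) (*-monoˡ-∣ n m∣du)))
    impossible : ⊥
    impossible with euclidsLemma m n pr p∣mn | euclidsLemma u n pr p∣un
    ... | inj₂ p∣n | _        = q∤v pr p∣n p∣v
    ... | _        | inj₂ p∣n = q∤v pr p∣n p∣v
    ... | inj₁ p∣m | inj₁ p∣u = ¬q∣uv pr p∣m (p∣u , p∣v)

zeroSumFree⇒¬HasBlock : ∀ m n {S : List (G m n)} → ZeroSumFree m n S →
                        ¬ HasBlock (ZeroSum m (m * n) (toℕ ∘ proj₁) (toℕ ∘ proj₂)) S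
zeroSumFree⇒¬HasBlock m n zsf (T , R , S↭ , T≢[] , m∣ , mn∣)
  with T′ , T′⊆S , T′↭T ← ⊆-resp-↭ (⊆.++⁺ʳ R (⊆-refl {x = T})) (↭-sym S↭) =
  zsf T′ T′⊆S (λ { refl → T≢[] (↭-empty T′↭T) })
    (subst (_ ∣_) (sym (weight-↭ (toℕ ∘ proj₁) T′↭T)) m∣ , subst (_ ∣_) (sym (weight-↭ (toℕ ∘ proj₂) T′↭T)) mn∣)
  where
  ↭-empty : ∀ {T : List (G m n)} → [] ↭ T → T ≡ []
  ↭-empty {[]}    p = refl
  ↭-empty {_ ∷ _} p = contradiction (↭-length p) λ ()

-- Each prime in `qs` spoils at most m - 1 terms, and all the others have order mn. Repetitions in
-- `qs` are allowed, and the bound is additive to avoid truncated subtraction.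
order-mn-sublist : ∀ m n .{{_ : NonZero m}} .{{_ : NonZero n}} (S : List (G m n)) →
                   ZeroSumFree m n S → length S ≡ m + m * n ∸ 2 →
                   ∀ qs → All (λ q → Prime q × q ∣ n) qs → (∀ {q} → Prime q → q ∣ n → q ∈ qs) →
                   Σ (List (G m n)) λ T → T ⊆ S × All (λ g → HasOrder m n g (m * n)) T
                     × m + m * n ≤ 2 + (length T + length qs * pred m)
order-mn-sublist m n S zsf |S| qs qs-prime qs-all = T , filter-⊆ good? S , All.tabulate order , bound
  where
  u v : G m n → ℕ
  u = toℕ ∘ proj₁
  v = toℕ ∘ proj₂
  bad? : Decidable (λ g → Any (_∣ v g) qs)
  bad? g = any? (_∣? v g) qs
  good? : Decidable (λ g → ¬ Any (_∣ v g) qs)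
  good? = ¬? ∘ bad?
  T = filter good? S
  long : m + m * n ≤ 2 + length S
  long = subst (λ l → m + m * n ≤ 2 + l) (sym |S|) (m≤n+m∸n (m + m * n) 2)
  free = zeroSumFree⇒¬HasBlock m n zsf
  few : ∀ {q} → Prime q × q ∣ n → length (filter (λ e → q ∣? v e) S) ≤ pred m
  few {q} (pr , divides n′ refl) = <⇒≤pred (few-multiples m n′ {{it}} {{m*n≢0⇒m≢0 n′}} pr u v S
    (subst (λ x → m + m * x ≤ 2 + length S) (*-comm n′ q) long)
    (subst (λ x → ¬ HasBlock (ZeroSum m (m * x) u v) S) (*-comm n′ q) free))
  none : ∀ {q g} → Prime q → q ∣ m → g ∈ S → ¬ (q ∣ u g × q ∣ v g)
  none {q} pr (divides m′ m≡) = no-common-multiple m′ n {{m′≢0}} pr u v S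
    (subst (λ x → x + x * n ≤ 2 + length S) m≡qm′ long)
    (subst (λ x → ¬ HasBlock (ZeroSum x (x * n) u v) S) m≡qm′ free)
    where
    m≡qm′ = trans m≡ (*-comm m′ q)
    m′≢0 : NonZero m′
    m′≢0 = m*n≢0⇒m≢0 m′ {{subst NonZero m≡ (>-nonZero (>-nonZero⁻¹ m))}}
  order : ∀ {g} → g ∈ T → HasOrder m n g (m * n)
  order {g} g∈T = hasOrder-mn m n g
    (λ pr q∣n q∣v → All.lookup (all-filter good? S) g∈T (Any.map (λ { refl → q∣v }) (qs-all pr q∣n)))
    (λ pr q∣m → none pr q∣m (lookup (filter-⊆ good? S) g∈T))
  bound : m + m * n ≤ 2 + (length T + length qs * pred m)
  bound = ≤-trans long (+-monoʳ-≤ 2 (≤-trans (≤-reflexive (length-filter-∁ bad? S))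
    (+-monoʳ-≤ (length T) (length-filter-any v qs (pred m) S (All.map few qs-prime)))))

-- Prime divisors of n

prime∣^⇒≡ : ∀ {p q} → Prime p → Prime q → ∀ k → q ∣ p ^ k → q ≡ p
prime∣^⇒≡ pp pq zero q∣1 = contradiction (∣1⇒≡1 q∣1) λ { refl → ¬prime[1] pq }
prime∣^⇒≡ {p} pp pq (suc k) q∣ with euclidsLemma p (p ^ k) pq q∣
... | inj₂ q∣p^k = prime∣^⇒≡ pp pq k q∣p^k
... | inj₁ q∣p with prime⇒irreducible pp q∣p
...   | inj₁ refl = contradiction pq ¬prime[1]
...   | inj₂ q≡p  = q≡p

-- The prime is listed without multiplicity, and not at all when n = 1: only m - 1 terms may be
-- lost.
primePower-primes : ∀ {n} → IsPrimePower n →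
                    ∃ λ qs → All (λ q → Prime q × q ∣ n) qs × (∀ {q} → Prime q → q ∣ n → q ∈ qs) × length qs ≤ 1
primePower-primes (p , zero , pp , refl) =
  [] , [] , (λ pq q∣1 → contradiction (prime∣^⇒≡ pp pq 0 q∣1) λ { refl → ¬prime[1] (subst Prime (∣1⇒≡1 q∣1) pp) }) , z≤n
primePower-primes (p , suc k , pp , refl) =
  p ∷ [] , (pp , m∣m*n (p ^ k)) ∷ [] , (λ pq q∣ → here (prime∣^⇒≡ pp pq (suc k) q∣)) , ≤-refl

2^length≤product : ∀ {qs} → All Prime qs → 2 ^ length qs ≤ product qs
2^length≤product []         = ≤-refl
2^length≤product (pr ∷ prs) = *-mono-≤ (nonTrivial⇒n>1 _ {{prime⇒nonTrivial pr}}) (2^length≤product prs)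

-- For r = ⌊log₂ n⌋ the conclusion fails only for the prime powers 4, 8 and 9.
5*r≤n+5 : ∀ {n} r → ¬ IsPrimePower n → 2 ^ r ≤ n → 5 * r ≤ n + 5
5*r≤n+5     0 _   _   = z≤n
5*r≤n+5 {n} 1 _   _   = m≤n+m 5 n
5*r≤n+5 {n} 2 ¬pp 4≤n = +-monoˡ-≤ 5 (≤∧≢⇒< 4≤n λ { refl → ¬pp (2 , 2 , prime[2] , refl) })
5*r≤n+5 {n} 3 ¬pp 8≤n = +-monoˡ-≤ 5 (≤∧≢⇒< (≤∧≢⇒< 8≤n λ { refl → ¬pp (2 , 3 , prime[2] , refl) })
                          λ { refl → ¬pp (3 , 2 , toWitness {a? = prime? 3} _ , refl) })
5*r≤n+5 {n} (suc (suc (suc (suc r)))) _ 2^r≤n = ≤-trans (exponential r) (+-monoˡ-≤ 5 2^r≤n)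
  where
  open ≤-Reasoning
  exponential : ∀ r → 5 * (4 + r) ≤ 2 ^ (4 + r) + 5
  exponential zero    = toWitness {a? = 20 ≤? 21} _
  exponential (suc r) = begin
    5 * (5 + r)                        ≡⟨ *-suc 5 (4 + r) ⟩
    5 + 5 * (4 + r)                    ≤⟨ +-mono-≤ 5≤2^ (exponential r) ⟩
    2 ^ (4 + r) + (2 ^ (4 + r) + 5)    ≡⟨ double (2 ^ (4 + r)) ⟩
    2 ^ (5 + r) + 5                    ∎
    where
    5≤2^ : 5 ≤ 2 ^ (4 + r)
    5≤2^ = ≤-trans (toWitness {a? = 5 ≤? 16} _) (^-monoʳ-≤ 2 (m≤m+n 4 r))
    double : ∀ x → x + (x + 5) ≡ 2 * x + 5
    double = solve-∀

-- The numerical bounds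

module _ {m n : ℕ} .{{_ : NonZero m}} where

  primePower-bound : ∀ {t} r → r ≤ 1 → m + m * n ≤ 2 + (t + r * pred m) → m * n ∸ 1 ≤ t
  primePower-bound {t} r r≤1 bound = m≤n+o⇒m∸n≤o _ 1 (+-cancelˡ-≤ m _ _ (begin
    m + m * n                 ≤⟨ bound ⟩
    2 + (t + r * pred m)      ≤⟨ +-monoʳ-≤ 2 (+-monoʳ-≤ t (*-monoˡ-≤ (pred m) r≤1)) ⟩
    2 + (t + 1 * pred m)      ≡⟨ regroup-sum t (pred m) ⟩
    suc (pred m) + (1 + t)    ≡⟨ cong (_+ (1 + t)) (suc-pred m) ⟩
    m + (1 + t)               ∎))
    where
    open ≤-Reasoning
    regroup-sum : ∀ t m → 2 + (t + 1 * m) ≡ suc m + (1 + t)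
    regroup-sum = solve-∀

  -- Multiplied by 5, the hypothesis on t gives 5t ≥ 5(m + mn - 2) - (n + 5)(m - 1) = 4mn + n - 5.
  ceil5-bound : ∀ {t} r → 5 * r ≤ n + 5 → m + m * n ≤ 2 + (t + r * pred m) → ceil5 (4 * m * n + n ∸ 5) ≤ t
  ceil5-bound {t} r 5r≤ bound = s≤s⁻¹ (m<n*o⇒m/o<n {n = suc t} (begin-strict
    4 * m * n + n ∸ 5 + 4   <⟨ +-monoʳ-< (4 * m * n + n ∸ 5) (n<1+n 4) ⟩
    4 * m * n + n ∸ 5 + 5   ≤⟨ +-monoˡ-≤ 5 (m≤n+o⇒m∸n≤o _ 5 (+-cancelʳ-≤ (5 * suc m′ + n * m′) _ _ key)) ⟩
    5 * t + 5               ≡⟨ last t ⟩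
    suc t * 5               ∎))
    where
    open ≤-Reasoning
    m′ = pred m
    m≡ : suc m′ ≡ m
    m≡ = suc-pred m
    last : ∀ t → 5 * t + 5 ≡ suc t * 5
    last = solve-∀
    lhs : ∀ m n → 4 * suc m * n + n + (5 * suc m + n * m) ≡ 5 * (suc m + suc m * n)
    lhs = solve-∀
    rhs : ∀ t r m → 5 * (2 + (t + r * m)) ≡ 10 + 5 * t + 5 * r * m
    rhs = solve-∀
    end : ∀ t n m → 10 + 5 * t + (n + 5) * m ≡ 5 + 5 * t + (5 * suc m + n * m)
    end = solve-∀
    -- The term 5m + n(m - 1) is added to both sides so that no subtraction occurs.
    key : 4 * m * n + n + (5 * suc m′ + n * m′) ≤ 5 + 5 * t + (5 * suc m′ + n * m′)
    key = begin
      4 * m * n + n + (5 * suc m′ + n * m′)        ≡⟨ cong (λ x → 4 * x * n + n + (5 * suc m′ + n * m′)) m≡ ⟨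
      4 * suc m′ * n + n + (5 * suc m′ + n * m′)   ≡⟨ lhs m′ n ⟩
      5 * (suc m′ + suc m′ * n)                    ≡⟨ cong (λ x → 5 * (x + x * n)) m≡ ⟩
      5 * (m + m * n)                              ≤⟨ *-monoʳ-≤ 5 bound ⟩
      5 * (2 + (t + r * m′))                       ≡⟨ rhs t r m′ ⟩
      10 + 5 * t + 5 * r * m′                      ≤⟨ +-monoʳ-≤ (10 + 5 * t) (*-monoˡ-≤ m′ 5r≤) ⟩
      10 + 5 * t + (n + 5) * m′                    ≡⟨ end t n m′ ⟩
      5 + 5 * t + (5 * suc m′ + n * m′)            ∎

theorem2p5 : (m n : ℕ) → .{{_ : NonZero m}} → .{{_ : NonZero n}} →
    (S : List (G m n)) → ZeroSumFree m n S → length S ≡ m + m * n ∸ 2 →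
    (IsPrimePower n →
    Σ (List (G m n)) λ T → T ⊆ S × All (λ g → HasOrder m n g (m * n)) T
    × (m * n ∸ 1 ≤ length T))
    × (¬ IsPrimePower n →
    Σ (List (G m n)) λ T → T ⊆ S × All (λ g → HasOrder m n g (m * n)) T
    × (ceil5 (4 * m * n + n ∸ 5) ≤ length T))
theorem2p5 m n S zsf |S| = case-i , case-ii
  where
  case-i : IsPrimePower n → _
  case-i pp =
    let qs , qs-prime , qs-all , |qs|≤1 = primePower-primes pp
        T , T⊆S , order , bound = order-mn-sublist m n S zsf |S| qs qs-prime qs-all
    in T , T⊆S , order , primePower-bound {m} {n} (length qs) |qs|≤1 bound
  case-ii : ¬ IsPrimePower n → _
  case-ii ¬pp =
    -- The prime factors are taken with multiplicity, which only weakens the bound and gives 2^r ≤ n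
    -- for their number r.
    let T , T⊆S , order , bound = order-mn-sublist m n S zsf |S| qs
          (All.tabulate λ q∈qs → All.lookup prs q∈qs , subst (_ ∣_) (sym n≡) (∈⇒∣product q∈qs))
          (λ pr q∣n → factorisationHasAllPrimeFactors pr (subst (_ ∣_) n≡ q∣n) prs)
    in T , T⊆S , order
       , ceil5-bound {m} {n} (length qs) (5*r≤n+5 (length qs) ¬pp (subst (2 ^ length qs ≤_) (sym n≡) (2^length≤product prs))) bound
    where
    open PrimeFactorisation (factorise n) renaming (factors to qs; isFactorisation to n≡; factorsPrime to prs)
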